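{- Let $N\geq 2$ and $M\geq 1$ be integers and let $L_1,\dots,L_M \in \mathbb{Z}[X_1,\dots,X_N]$ be non-zero linear forms, each having relatively prime coefficients. Then there exists $\boldsymbol{x} \in \mathbb{Z}^N$ such that $L_i(\boldsymbol{x}) \neq 0$ for every $i=1,\dots,M$ and $$H(\boldsymbol{x}) \leq \sum_{i=1}^M \frac{1}{H(L_i)} + \sqrt{M}.$$
   Context: For $\boldsymbol{x}=(x_1,\dots,x_N)\in\mathbb{Z}^N$, the height is $H(\boldsymbol{x})=\max_{1\leq i\leq N}|x_i|$. A linear form is a homogeneous polynomial $L=\sum_{i=1}^N q_iX_i$; its height is the height of its coefficient vector, $H(L)=\max_{1\leq i\leq N}|q_i|$. Relatively prime coefficients means $\gcd(q_1,\dots,q_N)=1$. -}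

module Defs where

open import Algebra.Properties.CommutativeMonoid.Sum using (sum)
open import Data.Fin.Base using (Fin; zero; suc)
open import Data.Integer.Base as ℤ using (ℤ; +_; 0ℤ; ∣_∣)
import Data.Integer.Properties as ℤₚ
open import Data.Nat.Base as ℕ using (ℕ; NonZero; _⊔_; ≢-nonZero)
open import Data.Nat.GCD using (gcd)
import Data.Nat.Properties as ℕₚ
open import Data.Product.Base using (_×_; ∃₂)
open import Data.Rational.Base as ℚ using (ℚ; 0ℚ; _/_)
import Data.Rational.Properties as ℚₚ
open import Data.Vec.Functional using (Vector; foldr; map; zipWith; tail)
open import Level using (0ℓ)
open import Relation.Binary.PropositionalEquality using (_≡_)
open import Relation.Nullary using (¬_)
open import Relation.Unary using (Pred; _∈_; _⊆_)

height : ∀ {N} → Vector ℤ N → ℕ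
height x = foldr _⊔_ 0 (map ∣_∣ x)

-- The form q₁X₁ + … + q_N X_N is given by its coefficients q₁, …, q_N.
LinearForm : ℕ → Set
LinearForm N = Vector ℤ N

eval : ∀ {N} → LinearForm N → Vector ℤ N → ℤ
eval L x = sum ℤₚ.+-0-commutativeMonoid (zipWith ℤ._*_ L x)

NonZeroForm : ∀ {N} → LinearForm N → Set
NonZeroForm L = ¬ (∀ j → L j ≡ 0ℤ)

RelativelyPrime : ∀ {N} → LinearForm N → Set
RelativelyPrime L = foldr gcd 0 (map ∣_∣ L) ≡ 1

height≡0⇒zero : ∀ {N} (x : Vector ℤ N) → height x ≡ 0 → ∀ j → x j ≡ 0ℤ
height≡0⇒zero x eq zero    = ℤₚ.∣i∣≡0⇒i≡0
  (ℕₚ.n≤0⇒n≡0 (ℕₚ.≤-trans (ℕₚ.m≤m⊔n _ _) (ℕₚ.≤-reflexive eq)))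
height≡0⇒zero x eq (suc j) = height≡0⇒zero (tail x)
  (ℕₚ.n≤0⇒n≡0 (ℕₚ.≤-trans (ℕₚ.m≤n⊔m ∣ x zero ∣ _) (ℕₚ.≤-reflexive eq))) j

height-nonZero : ∀ {N} (L : LinearForm N) → NonZeroForm L → NonZero (height L)
height-nonZero L L≢0 = ≢-nonZero (λ eq → L≢0 (height≡0⇒zero L eq))

sumInverseHeights : ∀ {N M} (L : Vector (LinearForm N) M) →
                    (∀ i → NonZeroForm (L i)) → ℚ
sumInverseHeights L L≢0 = sum ℚₚ.+-0-commutativeMonoid
  (λ i → _/_ (+ 1) (height (L i)) {{height-nonZero (L i) (L≢0 i)}})

-- A real number r is represented by its open upper Dedekind cut
-- {s ∈ ℚ | r < s}, which determines r; hence r ≤ r′ iff the cut of r′ is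
-- contained in that of r.  Only the reals built from ⟦_⟧, √_ and _+ᴿ_ occur,
-- and each of these operations yields a genuine open cut on such arguments.
UpperCut : Set₁
UpperCut = Pred ℚ 0ℓ

infix  4 _≤ᴿ_
infixl 6 _+ᴿ_
infix  8 √_

⟦_⟧ : ℚ → UpperCut
⟦ q ⟧ s = q ℚ.< s

√_ : ℕ → UpperCut
(√ n) s = 0ℚ ℚ.< s × (+ n / 1) ℚ.< s ℚ.* s

_+ᴿ_ : UpperCut → UpperCut → UpperCut
(U +ᴿ V) s = ∃₂ λ u v → u ∈ U × v ∈ V × s ≡ u ℚ.+ v

_≤ᴿ_ : UpperCut → UpperCut → Set
U ≤ᴿ V = V ⊆ U

{-# OPTIONS --safe #-}
-- Put S = ∑ 1/H(Lᵢ) and let R be the least natural number with M + R S < (R + 1)².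
--
-- A primitive form L of height H has at most (R/H + 1)(R + 1)ᴺ⁻² zeros in the box
-- {0, …, R}ᴺ.  More generally, let h be the absolute value of a nonzero coefficient
-- of q, and g the gcd of the coefficients: c + q has at most (R g/h + 1)(R + 1)ᴺ⁻²
-- zeros.  Adding a variable with coefficient a replaces g by gcd(a, g), and only the
-- values k of that variable with g ∣ c + a k contribute; these are congruent modulo
-- d = g / gcd(a, g), so there are at most R/d + 1 of them.
--
-- Hence the Lᵢ have at most (R S + M)(R + 1)ᴺ⁻² < (R + 1)ᴺ zeros in the box, which
-- leaves a point x with H(x) ≤ R.  If R > 0, minimality of R gives
-- R² ≤ M + (R − 1) S, which is impossible when R > S + √M.

module Submission where

open import Defs
open import Algebra.Properties.CommutativeMonoid.Sum using () renaming (sum to sumOf)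
open import Algebra.Properties.Semiring.Sum as Sum using ()
open import Data.Fin.Base as Fin using (Fin; zero; suc; toℕ)
import Data.Fin.Properties as Finₚ
open import Data.Integer.Base as ℤ using (ℤ; +_; 0ℤ; ∣_∣)
open import Data.Integer.Divisibility.Signed as ℤ∣ using () renaming (_∣_ to _∣ℤ_)
import Data.Integer.Properties as ℤₚ
import Data.Integer.Tactic.RingSolver as ℤSolver
open import Data.Nat.Base hiding (_/_)
import Data.Nat.Coprimality as Coprime
open import Data.Nat.Divisibility
open import Data.Nat.GCD
open import Data.Nat.Properties
open import Data.Nat.Tactic.RingSolver using (solve-∀)
open import Data.Product.Base using (_×_; _,_; Σ-syntax; ∃-syntax)
open import Data.Rational.Base as ℚ using (ℚ; 0ℚ; 1ℚ; _/_)
open import Data.Rational.Literals using (fromℤ)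
import Data.Rational.Properties as ℚₚ
open import Data.Rational.Solver using (module +-*-Solver)
open import Data.Sum.Base using (inj₁; inj₂)
open import Data.Vec.Functional using (Vector; foldr; map; head; tail; []; _∷_)
open import Function.Base using (_∘_; it)
open import Relation.Binary.PropositionalEquality
open import Relation.Nullary using (¬_; yes; no; contradiction)
open import Relation.Unary using (Pred; Decidable)

open Sum +-*-semiring using (sum; ∑-comm; sum-cong-≗; *-distribʳ-sum)

-- Bounded search, averaging, and sums with separated support.

-- Descends from `n` while `P` holds and stops at the first failure. Minimality is recorded as
-- failure at the predecessor, the form in which the radius estimate uses it.
least : ∀ {p} {P : Pred ℕ p} → Decidable P → ∀ n → P n →
        ∃[ m ] P m × (∀ k → m ≡ suc k → ¬ P k)
least P? zero    Pn = zero , Pn , λ _ ()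
least P? (suc n) Pn with P? n
... | yes Pn′ = least P? n Pn′
... | no ¬Pn′ = suc n , Pn , λ { _ refl → ¬Pn′ }

sum≢0⇒∃≢0 : ∀ {n} (f : Vector ℕ n) → sum f ≢ 0 → ∃[ i ] f i ≢ 0
sum≢0⇒∃≢0 {zero}  f ≢0 = contradiction refl ≢0
sum≢0⇒∃≢0 {suc n} f ≢0 with f zero ≟ 0
... | no  f₀≢0 = zero , f₀≢0
... | yes f₀≡0 with sum≢0⇒∃≢0 (tail f) (λ eq → ≢0 (cong₂ _+_ f₀≡0 eq))
...   | i , fᵢ≢0 = suc i , fᵢ≢0

-- Averaging: a first term that is at least `b` is cancelled against one copy of `b`, and the search
-- goes on in the tail.
sum<⇒∃< : ∀ n {b} (f : Vector ℕ n) → sum f < n * b → ∃[ i ] f i < b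
sum<⇒∃< (suc n) {b} f lt with f zero <? b
... | yes f₀<b = zero , f₀<b
... | no  f₀≮b with sum<⇒∃< n (tail f)
                     (+-cancelˡ-< b _ _ (≤-<-trans (+-monoˡ-≤ _ (≮⇒≥ f₀≮b)) lt))
...   | i , fᵢ<b = suc i , fᵢ<b

-- The slack t drives the induction: for the tail it is d - 1 after a point of the
-- support and t - 1 (at least 0) otherwise.
separated-sum : ∀ {n} (f : Vector ℕ n) {b d} t → t < d →
                (∀ i → f i ≤ b) →
                (∀ i → f i ≢ 0 → t ≤ toℕ i) →
                (∀ i j → f i ≢ 0 → f j ≢ 0 → i Fin.< j → d ≤ toℕ j ∸ toℕ i) →
                sum f * d + (t + 1) * b ≤ (n + d) * b
separated-sum {zero} f {b} {d} t t<d f≤b low sep =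
  *-monoˡ-≤ b (subst (_≤ d) (+-comm 1 t) t<d)
separated-sum {suc n} f {b} {suc d} t (s≤s t≤d) f≤b low sep with f zero ≟ 0
-- A support point at index 0 forces `t` to be 0, because `low` bounds `t` by that index.
... | no f₀≢0 rewrite n≤0⇒n≡0 (low zero f₀≢0) = begin
  (f zero + s) * suc d + 1 * b        ≡⟨ eq₁ (f zero) s d b ⟩
  f zero * suc d + (s * suc d + b)    ≤⟨ +-monoˡ-≤ _ (*-monoˡ-≤ (suc d) (f≤b zero)) ⟩
  b * suc d + (s * suc d + b)         ≡⟨ eq₂ s d b ⟩
  b + (s * suc d + (d + 1) * b)       ≤⟨ +-monoʳ-≤ b (separated-sum (tail f) d ≤-refl (f≤b ∘ suc)
                                          (λ i fᵢ≢0 → ≤-pred (sep zero (suc i) f₀≢0 fᵢ≢0 z<s))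
                                          (λ i j p q i<j → sep (suc i) (suc j) p q (s<s i<j))) ⟩
  b + (n + suc d) * b                 ∎
  where
  open ≤-Reasoning
  s = sum (tail f)
  eq₁ : ∀ x s d b → (x + s) * (1 + d) + 1 * b ≡ x * (1 + d) + (s * (1 + d) + b)
  eq₁ = solve-∀
  eq₂ : ∀ s d b → b * (1 + d) + (s * (1 + d) + b) ≡ b + (s * (1 + d) + (d + 1) * b)
  eq₂ = solve-∀
... | yes f₀≡0 rewrite f₀≡0 = begin
  s * suc d + (t + 1) * b             ≤⟨ +-monoʳ-≤ (s * suc d) (*-monoˡ-≤ b t+1≤) ⟩
  s * suc d + (pred t + 1 + 1) * b    ≡⟨ eq s d (pred t) b ⟩
  b + (s * suc d + (pred t + 1) * b)  ≤⟨ +-monoʳ-≤ b (separated-sum (tail f) (pred t)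
                                           (s≤s (≤-trans pred[n]≤n t≤d)) (f≤b ∘ suc)
                                           (λ i fᵢ≢0 → pred-mono-≤ (low (suc i) fᵢ≢0))
                                           (λ i j p q i<j → sep (suc i) (suc j) p q (s<s i<j))) ⟩
  b + (n + suc d) * b                 ∎
  where
  open ≤-Reasoning
  s = sum (tail f)
  t+1≤ : t + 1 ≤ pred t + 1 + 1
  t+1≤ = +-monoˡ-≤ 1 (subst (t ≤_) (+-comm 1 (pred t)) (suc-pred-≤ t))
    where
    suc-pred-≤ : ∀ t → t ≤ suc (pred t)
    suc-pred-≤ zero    = z≤n
    suc-pred-≤ (suc t) = ≤-refl
  eq : ∀ s d t b → s * (1 + d) + (t + 1 + 1) * b ≡ b + (s * (1 + d) + (t + 1) * b)
  eq = solve-∀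

-- Gcds of coefficient vectors and the height.

foldr-gcd-∣ : ∀ {N} n (v : Vector ℕ N) → foldr gcd n v ∣ n
foldr-gcd-∣ {zero}  n v = ∣-refl
foldr-gcd-∣ {suc N} n v = ∣-trans (gcd[m,n]∣n (head v) _) (foldr-gcd-∣ n (tail v))

foldr-gcd-∣-lookup : ∀ {N} n (v : Vector ℕ N) j → foldr gcd n v ∣ v j
foldr-gcd-∣-lookup n v zero    = gcd[m,n]∣m (head v) _
foldr-gcd-∣-lookup n v (suc j) = ∣-trans (gcd[m,n]∣n (head v) _) (foldr-gcd-∣-lookup n (tail v) j)

-- When the count starts from a chosen coefficient, its absolute value is the initial value of the
-- gcd fold; this moves it back to the front.
foldr-gcd-init : ∀ {N} n (v : Vector ℕ N) → foldr gcd n v ≡ gcd n (foldr gcd 0 v)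
foldr-gcd-init {zero}  n v = ∣-antisym (gcd-greatest ∣-refl (n ∣0)) (gcd[m,n]∣m n 0)
foldr-gcd-init {suc N} n v = begin
  gcd (head v) (foldr gcd n (tail v))         ≡⟨ cong (gcd (head v)) (foldr-gcd-init n (tail v)) ⟩
  gcd (head v) (gcd n (foldr gcd 0 (tail v))) ≡⟨ gcd-assoc (head v) n _ ⟨
  gcd (gcd (head v) n) (foldr gcd 0 (tail v)) ≡⟨ cong (λ m → gcd m _) (gcd-comm (head v) n) ⟩
  gcd (gcd n (head v)) (foldr gcd 0 (tail v)) ≡⟨ gcd-assoc n (head v) _ ⟩
  gcd n (gcd (head v) (foldr gcd 0 (tail v))) ∎
  where open ≡-Reasoning

height-attained : ∀ {N} (x : Vector ℤ (suc N)) → ∃[ j ] ∣ x j ∣ ≡ height x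
height-attained {zero}  x = zero , sym (⊔-identityʳ _)
height-attained {suc N} x with ⊔-sel ∣ x zero ∣ (height (tail x))
... | inj₁ eq = zero , sym eq
... | inj₂ eq with height-attained (tail x)
...   | j , eqⱼ = suc j , trans eqⱼ (sym eq)

-- Counting zeros in a box.

module Box (R : ℕ) where

  side : ℕ
  side = suc R

  shift : ℤ → ℤ → Fin side → ℤ
  shift a c k = c ℤ.+ a ℤ.* + toℕ k

  -- An operator on functions of the constant term: one variable with coefficient `a` is summed out,
  -- so that counting over the box is a fold of such operators.
  shiftSum : ℤ → (ℤ → ℕ) → ℤ → ℕ
  shiftSum a f c = sum (f ∘ shift a c)

  atZero : ℤ → ℕ
  atZero c with c ℤₚ.≟ 0ℤ
  ... | yes _ = 1
  ... | no  _ = 0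

  -- The number of x ∈ {0, …, R}ᴺ with c + L(x) = 0.
  zeros : ∀ {N} → LinearForm N → ℤ → ℕ
  zeros = foldr shiftSum atZero

  atZero≤1 : ∀ c → atZero c ≤ 1
  atZero≤1 c with c ℤₚ.≟ 0ℤ
  ... | yes _ = ≤-refl
  ... | no  _ = z≤n

  atZero≢0 : ∀ c → atZero c ≢ 0 → c ≡ 0ℤ
  atZero≢0 c ≢0 with c ℤₚ.≟ 0ℤ
  ... | yes c≡0 = c≡0
  ... | no  _   = contradiction refl ≢0

  atZero<1 : ∀ c → atZero c < 1 → c ≢ 0ℤ
  atZero<1 c lt with c ℤₚ.≟ 0ℤ
  ... | no c≢0 = c≢0
  atZero<1 c (s<s ()) | yes _

  shiftSum-comm : ∀ a b f c → shiftSum a (shiftSum b f) c ≡ shiftSum b (shiftSum a f) c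
  shiftSum-comm a b f c = trans
    (∑-comm {side} {side} (λ k l → f (shift b (shift a c k) l)))
    (sum-cong-≗ {side} (λ l → sum-cong-≗ {side} (λ k → cong f (swap c (a ℤ.* + toℕ k) (b ℤ.* + toℕ l)))))
    where
    swap : ∀ x y z → (x ℤ.+ y) ℤ.+ z ≡ (x ℤ.+ z) ℤ.+ y
    swap = ℤSolver.solve-∀

  -- Exchanging finite sums lets a chosen nonzero coefficient be moved innermost, where it starts
  -- the sparsity induction.
  foldr-shiftSum-comm : ∀ {N} (q : LinearForm N) a f c →
                        foldr shiftSum (shiftSum a f) q c ≡ shiftSum a (foldr shiftSum f q) c
  foldr-shiftSum-comm {zero}  q a f c = refl
  foldr-shiftSum-comm {suc N} q a f c = trans
    (sum-cong-≗ (λ k → foldr-shiftSum-comm (tail q) a f (shift (head q) c k)))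
    (shiftSum-comm (head q) a (foldr shiftSum f (tail q)) c)

  -- Coordinates are fixed one at a time: by averaging, some value of the first variable leaves
  -- fewer than `side ^ N` zeros in the remaining `N` variables. With no variable left the total is
  -- below 1, so no constant term vanishes.
  sum-zeros<⇒∃x : ∀ {N M} (L : Vector (LinearForm N) M) (c : Vector ℤ M) →
                  sum (λ i → zeros (L i) (c i)) < side ^ N →
                  Σ[ x ∈ Vector ℤ N ] height x ≤ R × (∀ i → c i ℤ.+ eval (L i) x ≢ 0ℤ)
  sum-zeros<⇒∃x {zero} L c lt = [] , z≤n , λ i →
    atZero<1 (c i) (≤-<-trans (term≤sum _ i) lt) ∘ trans (sym (ℤₚ.+-identityʳ (c i)))
    where
    term≤sum : ∀ {n} (f : Vector ℕ n) i → f i ≤ sum f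
    term≤sum f zero    = m≤m+n _ _
    term≤sum f (suc i) = ≤-trans (term≤sum (tail f) i) (m≤n+m _ _)
  sum-zeros<⇒∃x {suc N} {M} L c lt
    with sum<⇒∃< side (λ k → sum (λ i → zeros (tail (L i)) (shift (head (L i)) (c i) k)))
           (subst (_< side ^ suc N) (∑-comm {M} {side} (λ i k → zeros (tail (L i)) (shift (head (L i)) (c i) k))) lt)
  ... | k , ltₖ with sum-zeros<⇒∃x (tail ∘ L) _ ltₖ
  ...   | x , hx≤R , avoids =
    + toℕ k ∷ x , ⊔-lub (≤-pred (Finₚ.toℕ<n k)) hx≤R ,
    λ i → avoids i ∘ trans (ℤₚ.+-assoc (c i) _ _)

  -- Divisibility and sparsity of the zeros.

  -- Meant for f c = the number of zeros of c + q over a box, with g the gcd of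
  -- the coefficients of q, h one of them in absolute value, and E = sideⁿ⁻¹ when
  -- q has n coefficients.  The factor side on the left lets n = 1 fit the same
  -- shape, where f c ≤ 1.
  record Sparse (f : ℤ → ℕ) (g h E : ℕ) : Set where
    field
      support : ∀ c → f c ≢ 0 → + g ∣ℤ c
      bound   : ∀ c → f c * (h * side) ≤ (R * g + h) * E

  open Sparse

  shift-diff : ∀ a c k l → shift a c l ℤ.- shift a c k ≡ a ℤ.* (+ toℕ l ℤ.- + toℕ k)
  shift-diff a c k l = lemma a c (+ toℕ k) (+ toℕ l)
    where
    lemma : ∀ a c k l → (c ℤ.+ a ℤ.* l) ℤ.- (c ℤ.+ a ℤ.* k) ≡ a ℤ.* (l ℤ.- k)
    lemma = ℤSolver.solve-∀

  -- Used twice: `g = 0` rules out two zeros of a nonconstant `c + a k`, and a general `g` yields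
  -- the gap between contributing values.
  ∣-shift-diff : ∀ {g} a c {k l : Fin side} → k Fin.< l →
                 + g ∣ℤ shift a c k → + g ∣ℤ shift a c l →
                 g ∣ ∣ a ∣ * (toℕ l ∸ toℕ k)
  ∣-shift-diff {g} a c {k} {l} k<l p q = subst (g ∣_)
    (trans (ℤₚ.abs-* a _) (cong (λ z → ∣ a ∣ * ∣ z ∣) (trans (ℤₚ.m-n≡m⊖n (toℕ l) (toℕ k)) (ℤₚ.⊖-≥ (<⇒≤ k<l)))))
    (ℤ∣.∣⇒∣ᵤ (subst (+ g ∣ℤ_) (shift-diff a c k l) (ℤ∣.∣m∣n⇒∣m-n q p)))

  -- Some term is nonzero, so `g` divides `c + a k` for some `k`; the gcd divides both this and
  -- `a k`.
  shiftSum-support : ∀ {f : ℤ → ℕ} {g} a → (∀ c → f c ≢ 0 → + g ∣ℤ c) →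
                     ∀ c → shiftSum a f c ≢ 0 → + gcd ∣ a ∣ g ∣ℤ c
  shiftSum-support {f} {g} a supp c ≢0 with sum≢0⇒∃≢0 (f ∘ shift a c) ≢0
  ... | k , fₖ≢0 = ℤ∣.∣m+n∣n⇒∣m
    (ℤ∣.∣-trans (ℤ∣.∣ᵤ⇒∣ (gcd[m,n]∣n ∣ a ∣ g)) (supp _ fₖ≢0))
    (ℤ∣.∣m⇒∣m*n (+ toℕ k) (ℤ∣.∣ᵤ⇒∣ {i = a} (gcd[m,n]∣m ∣ a ∣ g)))

  shiftSum-atZero : ∀ a → .{{NonZero ∣ a ∣}} → Sparse (shiftSum a atZero) ∣ a ∣ ∣ a ∣ 1
  shiftSum-atZero a = λ where
      -- `atZero` is supported on the multiples of 0, so the gcd to consider is that of `∣ a ∣` and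
      -- 0.
      .support c ≢0 → subst (λ g → + g ∣ℤ c) (gcd[n,0]≡n ∣ a ∣)
        (shiftSum-support a (λ c′ p → subst (+ 0 ∣ℤ_) (sym (atZero≢0 c′ p)) ℤ∣.∣-refl) c ≢0)
      .bound c → begin
        shiftSum a atZero c * (h * side)  ≤⟨ *-monoˡ-≤ (h * side) (≤1 c) ⟩
        1 * (h * side)                    ≡⟨ eq h R ⟩
        (R * h + h) * 1                   ∎
    where
    open ≤-Reasoning
    h = ∣ a ∣
    gcd[n,0]≡n : ∀ n → gcd n 0 ≡ n
    gcd[n,0]≡n n = ∣-antisym (gcd[m,n]∣m n 0) (gcd-greatest ∣-refl (n ∣0))
    eq : ∀ h R → 1 * (h * (1 + R)) ≡ (R * h + h) * 1
    eq = solve-∀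
    -- There cannot be two zeros, so every d is allowed in separated-sum; d = side is
    -- large enough to leave room for only one.
    ≤1 : ∀ c → shiftSum a atZero c ≤ 1
    ≤1 c = ≤-pred (*-cancelʳ-< side _ 2 (begin-strict
      s * side          <⟨ m<m+n _ z<s ⟩
      s * side + 1 * 1  ≤⟨ separated-sum (atZero ∘ shift a c) 0 z<s (λ k → atZero≤1 _) (λ _ _ → z≤n) sep ⟩
      (side + side) * 1 ≡⟨ eq′ side ⟩
      2 * side          ∎))
      where
      s = shiftSum a atZero c
      eq′ : ∀ m → (m + m) * 1 ≡ 2 * m
      eq′ = solve-∀
      sep : ∀ k l → atZero (shift a c k) ≢ 0 → atZero (shift a c l) ≢ 0 → k Fin.< l →
            side ≤ toℕ l ∸ toℕ k
      sep k l p q k<l = contradiction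
        (0∣⇒≡0 (∣-shift-diff a c k<l (ℤ∣.∣-reflexive (sym (atZero≢0 _ p))) (ℤ∣.∣-reflexive (sym (atZero≢0 _ q)))))
        (≢-nonZero⁻¹ _ {{m*n≢0 h _ {{it}} {{>-nonZero (m<n⇒0<n∸m k<l)}}}})

  -- Put `d = g / gcd ∣ a ∣ g` and `e = h / g`. Contributing values are at least `d` apart, so
  -- summing multiplies the bound by at most `(R + d) / d`. The shape survives because `(R + 1)(R +
  -- d e) - (R + d)(R + e) = R (d - 1)(e - 1)` is nonnegative.
  shiftSum-sparse : ∀ {f g h E} a → .{{NonZero h}} → g ∣ h → Sparse f g h E →
                    Sparse (shiftSum a f) (gcd ∣ a ∣ g) h (side * E)
  shiftSum-sparse {f} {g′} {h} {E} a g′∣h@(divides e h≡eg′) sparse = λ where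
      .support → shiftSum-support a (sparse .support)
      .bound c → *-cancelʳ-≤ _ _ d {{d≢0}} (begin
        shiftSum a f c * (h * side) * d     ≡⟨ cong (_* d) (*-distribʳ-sum (h * side) (f ∘ shift a c)) ⟩
        -- Slack 0 leaves one copy of `b` on the left; it cancels one of the `side + d = R + 1 + d`
        -- copies on the right.
        sum (F c) * d                       ≤⟨ +-cancelʳ-≤ (1 * b) _ _ (≤-trans
                                                (separated-sum (F c) 0 (>-nonZero⁻¹ d {{d≢0}}) (λ _ → sparse .bound _) (λ _ _ → z≤n) (sep c))
                                                (≤-reflexive (eq₀ R d b))) ⟩
        (R + d) * b                         ≡⟨ cong (λ g → (R + d) * ((R * g + h) * E)) g′≡dg ⟩
        (R + d) * ((R * (d * g) + h) * E)   ≡⟨ cong (λ h → (R + d) * ((R * (d * g) + h) * E)) h≡edg ⟩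
        (R + d) * ((R * (d * g) + e * (d * g)) * E)
                                            ≡⟨ eq₁ R d e g E ⟩
        (R * (d + e) + (R * R + e * d)) * (d * g * E)
                                            ≤⟨ *-monoˡ-≤ (d * g * E) (+-monoˡ-≤ _ (*-monoʳ-≤ R d+e≤1+de)) ⟩
        (R * (1 + d * e) + (R * R + e * d)) * (d * g * E)
                                            ≡⟨ eq₂ R d e g E ⟩
        (R * g + e * (d * g)) * (side * E) * d
                                            ≡⟨ cong (λ h → (R * g + h) * (side * E) * d) h≡edg ⟨
        (R * g + h) * (side * E) * d        ∎)
    where
    open ≤-Reasoning
    g = gcd ∣ a ∣ g′
    d = quotient (gcd[m,n]∣n ∣ a ∣ g′)
    b = (R * g′ + h) * E

    F : ℤ → Fin side → ℕ
    F c k = f (shift a c k) * (h * side)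

    g′≡dg : g′ ≡ d * g
    g′≡dg = _∣_.equality (gcd[m,n]∣n ∣ a ∣ g′)

    h≡edg : h ≡ e * (d * g)
    h≡edg = trans h≡eg′ (cong (e *_) g′≡dg)

    d≢0 : NonZero d
    d≢0 = ≢-nonZero λ d≡0 → ≢-nonZero⁻¹ h
      (trans h≡edg (trans (cong (λ d → e * (d * g)) d≡0) (*-zeroʳ e)))

    g≢0 : NonZero g
    g≢0 = ≢-nonZero λ g≡0 → ≢-nonZero⁻¹ h
      (trans h≡edg (trans (cong (λ g → e * (d * g)) g≡0) (trans (cong (e *_) (*-zeroʳ d)) (*-zeroʳ e))))

    e≢0 : NonZero e
    e≢0 = ≢-nonZero λ e≡0 → ≢-nonZero⁻¹ h (trans h≡eg′ (cong (_* g′) e≡0))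

    d+e≤1+de : d + e ≤ 1 + d * e
    d+e≤1+de = lemma d e {{d≢0}} {{e≢0}}
      where
      eq : ∀ d e → 1 + (1 + d) * (1 + e) ≡ (1 + d + (1 + e)) + d * e
      eq = solve-∀
      lemma : ∀ d e → .{{NonZero d}} → .{{NonZero e}} → d + e ≤ 1 + d * e
      lemma (suc d) (suc e) = ≤-trans (m≤m+n _ (d * e)) (≤-reflexive (sym (eq d e)))

    sep : ∀ c k l → F c k ≢ 0 → F c l ≢ 0 → k Fin.< l → d ≤ toℕ l ∸ toℕ k
    -- `g′` divides both `m ∣ a ∣` and `m g′`, hence `m g`. Cancelling `g` from `d g ∣ m g` gives
    -- `d ∣ m`, and `m` is positive.
    sep c k l p q k<l = ∣⇒≤ {{>-nonZero (m<n⇒0<n∸m k<l)}}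
      (*-cancelʳ-∣ g {{g≢0}} (subst₂ _∣_ g′≡dg gcd≡ (gcd-greatest
        (subst (g′ ∣_) (*-comm ∣ a ∣ m) (∣-shift-diff a c k<l (supp k p) (supp l q)))
        (n∣m*n m))))
      where
      m = toℕ l ∸ toℕ k
      gcd≡ : gcd (m * ∣ a ∣) (m * g′) ≡ m * g
      gcd≡ = sym (c*gcd[m,n]≡gcd[cm,cn] m ∣ a ∣ g′)
      supp : ∀ k → F c k ≢ 0 → + g′ ∣ℤ shift a c k
      supp k p = sparse .support _ (λ eq → p (cong (_* (h * side)) eq))

    eq₀ : ∀ R d b → (1 + R + d) * b ≡ (R + d) * b + 1 * b
    eq₀ = solve-∀
    eq₁ : ∀ R d e g E → (R + d) * ((R * (d * g) + e * (d * g)) * E)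
                      ≡ (R * (d + e) + (R * R + e * d)) * (d * g * E)
    eq₁ = solve-∀
    eq₂ : ∀ R d e g E → (R * (1 + d * e) + (R * R + e * d)) * (d * g * E)
                      ≡ (R * g + e * (d * g)) * ((1 + R) * E) * d
    eq₂ = solve-∀

  -- The innermost coefficient `a` serves as `h` throughout: every gcd met on the way out divides
  -- `∣ a ∣`, as `shiftSum-sparse` requires.
  foldr-shiftSum-sparse : ∀ {N} (q : LinearForm N) a → .{{NonZero ∣ a ∣}} →
    Sparse (foldr shiftSum (shiftSum a atZero) q) (foldr gcd ∣ a ∣ (map ∣_∣ q)) ∣ a ∣ (side ^ N)
  foldr-shiftSum-sparse {zero}  q a = shiftSum-atZero a
  foldr-shiftSum-sparse {suc N} q a =
    shiftSum-sparse (head q) (foldr-gcd-∣ ∣ a ∣ (map ∣_∣ (tail q))) (foldr-shiftSum-sparse (tail q) a)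

  zeros-sparse : ∀ {N} (q : LinearForm (suc N)) j → .{{NonZero ∣ q j ∣}} →
                 Sparse (zeros q) (foldr gcd 0 (map ∣_∣ q)) ∣ q j ∣ (side ^ N)
  -- The chosen coefficient is outermost here, so it is first commuted to the inside.
  zeros-sparse {N} q zero = λ where
      .support c ≢0 → subst (λ g → + g ∣ℤ c) (foldr-gcd-init ∣ q zero ∣ (map ∣_∣ (tail q)))
        (sparse .support c (≢0 ∘ trans (sym (comm c))))
      .bound c → subst₂ (λ s g → s * (∣ q zero ∣ * side) ≤ (R * g + ∣ q zero ∣) * side ^ N)
        (comm c) (foldr-gcd-init ∣ q zero ∣ (map ∣_∣ (tail q))) (sparse .bound c)
    where
    sparse = foldr-shiftSum-sparse (tail q) (q zero)
    comm = foldr-shiftSum-comm (tail q) (q zero) atZero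
  zeros-sparse {suc N} q (suc j) =
    shiftSum-sparse (head q) (foldr-gcd-∣-lookup 0 (map ∣_∣ (tail q)) j) (zeros-sparse (tail q) j)

  -- Takes for `h` a coefficient attaining the height; primitivity makes the gcd 1. With at least
  -- two variables `E` contains a factor `side`, which cancels the one on the left.
  zeros-bound : ∀ {N} (q : LinearForm (2 + N)) c → .{{NonZero (height q)}} → RelativelyPrime q →
                zeros q c * height q ≤ (R + height q) * side ^ N
  zeros-bound {N} q c {{h≢0}} prime with height-attained q
  ... | j , eq = *-cancelʳ-≤ _ _ side (begin
    zeros q c * height q * side              ≡⟨ *-assoc (zeros q c) _ _ ⟩
    zeros q c * (height q * side)            ≡⟨ cong (λ h → zeros q c * (h * side)) eq ⟨
    zeros q c * (∣ q j ∣ * side)             ≤⟨ Sparse.bound (zeros-sparse q j {{subst NonZero (sym eq) h≢0}}) c ⟩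
    (R * foldr gcd 0 (map ∣_∣ q) + ∣ q j ∣) * (side * side ^ N)
                                             ≡⟨ cong₂ (λ g h → (R * g + h) * (side * side ^ N)) prime eq ⟩
    (R * 1 + height q) * (side * side ^ N)   ≡⟨ eq′ R (height q) (side ^ N) ⟩
    (R + height q) * side ^ N * side         ∎)
    where
    open ≤-Reasoning
    eq′ : ∀ R h E → (R * 1 + h) * ((1 + R) * E) ≡ (R + h) * E * (1 + R)
    eq′ = solve-∀

-- Naturals, reciprocals and their sums as rationals.

-- Opaque, since otherwise the type checker unfolds the gcds hidden in _/_.
opaque

  ι : ℕ → ℚ
  ι n = + n / 1

  1/ι : ∀ n → .{{NonZero n}} → ℚ
  1/ι n = + 1 / n

  ι-def : ∀ n → ι n ≡ + n / 1
  ι-def n = refl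

  1/ι-def : ∀ n → .{{_ : NonZero n}} → 1/ι n ≡ + 1 / n
  1/ι-def n = refl

-- `fromℤ` is already in lowest terms, so rational arithmetic and order on it reduce to those of the
-- numerators.
ι≡fromℤ : ∀ n → ι n ≡ fromℤ (+ n)
ι≡fromℤ n = trans (ι-def n) (ℚₚ.normalize-coprime (Coprime.sym (Coprime.1-coprimeTo n)))

ι-homo-+ : ∀ m n → ι (m + n) ≡ ι m ℚ.+ ι n
ι-homo-+ m n = trans
  (trans (ι-def (m + n)) (cong (_/ 1) (sym (cong₂ ℤ._+_ (ℤₚ.*-identityʳ (+ m)) (ℤₚ.*-identityʳ (+ n))))))
  (sym (cong₂ ℚ._+_ (ι≡fromℤ m) (ι≡fromℤ n)))

ι-homo-* : ∀ m n → ι (m * n) ≡ ι m ℚ.* ι n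
ι-homo-* m n = trans
  (trans (ι-def (m * n)) (cong (_/ 1) (ℤₚ.pos-* m n)))
  (sym (cong₂ ℚ._*_ (ι≡fromℤ m) (ι≡fromℤ n)))

ι-suc : ∀ n → ι (suc n) ≡ 1ℚ ℚ.+ ι n
ι-suc n = trans (ι-homo-+ 1 n) (cong (ℚ._+ ι n) (ι≡fromℤ 1))

ι-mono-≤ : ∀ {m n} → m ≤ n → ι m ℚ.≤ ι n
ι-mono-≤ {m} {n} m≤n = subst₂ ℚ._≤_ (sym (ι≡fromℤ m)) (sym (ι≡fromℤ n))
  (ℚ.*≤* (ℤₚ.*-monoʳ-≤-nonNeg (+ 1) (ℤ.+≤+ m≤n)))

ι-mono-< : ∀ {m n} → m < n → ι m ℚ.< ι n
ι-mono-< {m} {n} m<n = subst₂ ℚ._<_ (sym (ι≡fromℤ m)) (sym (ι≡fromℤ n))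
  (ℚ.*<* (ℤₚ.*-monoʳ-<-pos (+ 1) (ℤ.+<+ m<n)))

ι-cancel-< : ∀ {m n} → ι m ℚ.< ι n → m < n
ι-cancel-< ιm<ιn = ≰⇒> λ n≤m → ℚₚ.<-irrefl refl (ℚₚ.<-≤-trans ιm<ιn (ι-mono-≤ n≤m))

ι-nonNeg : ∀ n → ℚ.NonNegative (ι n)
ι-nonNeg n = subst ℚ.NonNegative (sym (ι≡fromℤ n)) _

ι-pos : ∀ n → .{{_ : NonZero n}} → ℚ.Positive (ι n)
ι-pos (suc n) = subst ℚ.Positive (sym (ι≡fromℤ (suc n))) _

1/ι-nonNeg : ∀ n → .{{_ : NonZero n}} → ℚ.NonNegative (1/ι n)
1/ι-nonNeg n = subst ℚ.NonNegative (sym (1/ι-def n)) (ℚₚ.normalize-nonNeg 1 n)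

ι*1/ι : ∀ n → .{{_ : NonZero n}} → ι n ℚ.* 1/ι n ≡ 1ℚ
ι*1/ι (suc n) = trans
  (cong₂ ℚ._*_ (ι≡fromℤ (suc n))
    (trans (1/ι-def (suc n)) (ℚₚ.normalize-coprime (Coprime.1-coprimeTo (suc n)))))
  (ℚₚ.*-inverseʳ (fromℤ (+ suc n)))

*-mono-≤-nonNeg : ∀ {p q r s} → 0ℚ ℚ.≤ q → 0ℚ ℚ.≤ r → p ℚ.≤ q → r ℚ.≤ s → p ℚ.* r ℚ.≤ q ℚ.* s
*-mono-≤-nonNeg {p} {q} {r} {s} 0≤q 0≤r p≤q r≤s = ℚₚ.≤-trans
  (ℚₚ.*-monoʳ-≤-nonNeg r {{ℚ.nonNegative 0≤r}} p≤q)
  (ℚₚ.*-monoˡ-≤-nonNeg q {{ℚ.nonNegative 0≤q}} r≤s)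

sumInverses : ∀ {M} (h : Vector ℕ M) → (∀ i → NonZero (h i)) → ℚ
sumInverses h h≢0 = sumOf ℚₚ.+-0-commutativeMonoid (λ i → 1/ι (h i) {{h≢0 i}})

sumInverses-nonNeg : ∀ {M} (h : Vector ℕ M) h≢0 → 0ℚ ℚ.≤ sumInverses h h≢0
sumInverses-nonNeg {zero}  h h≢0 = ℚₚ.≤-refl
sumInverses-nonNeg {suc M} h h≢0 = ℚₚ.+-mono-≤
  (ℚₚ.nonNegative⁻¹ (1/ι (h zero) {{h≢0 zero}}) {{1/ι-nonNeg (h zero) {{h≢0 zero}}}})
  (sumInverses-nonNeg (tail h) (h≢0 ∘ suc))

1/ι≤1 : ∀ n → .{{_ : NonZero n}} → 1/ι n ℚ.≤ 1ℚ
1/ι≤1 n = begin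
  1/ι n          ≡⟨ ℚₚ.*-identityˡ (1/ι n) ⟨
  1ℚ ℚ.* 1/ι n   ≤⟨ ℚₚ.*-monoʳ-≤-nonNeg (1/ι n) {{1/ι-nonNeg n}}
                      (subst (ℚ._≤ ι n) (ι≡fromℤ 1) (ι-mono-≤ (>-nonZero⁻¹ n))) ⟩
  ι n ℚ.* 1/ι n  ≡⟨ ι*1/ι n ⟩
  1ℚ             ∎
  where open ℚₚ.≤-Reasoning

sumInverses≤M : ∀ {M} (h : Vector ℕ M) h≢0 → sumInverses h h≢0 ℚ.≤ ι M
sumInverses≤M {zero}  h h≢0 = ℚₚ.≤-reflexive (sym (ι≡fromℤ 0))
sumInverses≤M {suc M} h h≢0 = subst (sumInverses h h≢0 ℚ.≤_) (sym (ι-suc M))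
  (ℚₚ.+-mono-≤ (1/ι≤1 (h zero) {{h≢0 zero}}) (sumInverses≤M (tail h) (h≢0 ∘ suc)))

-- Rational bound for the total number of zeros.

module _ (R E : ℕ) where

  divide-bound : ∀ c h → .{{_ : NonZero h}} → c * h ≤ (R + h) * E →
                 ι c ℚ.≤ (1ℚ ℚ.+ ι R ℚ.* 1/ι h) ℚ.* ι E
  divide-bound c h ch≤ = begin
    ι c                                       ≡⟨ cancel (ι c) ⟩
    ι c ℚ.* ι h ℚ.* 1/ι h                     ≡⟨ cong (ℚ._* 1/ι h) (ι-homo-* c h) ⟨
    ι (c * h) ℚ.* 1/ι h                       ≤⟨ ℚₚ.*-monoʳ-≤-nonNeg (1/ι h) {{1/ι-nonNeg h}} (ι-mono-≤ ch≤) ⟩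
    ι ((R + h) * E) ℚ.* 1/ι h                 ≡⟨ cong (ℚ._* 1/ι h) (trans (ι-homo-* (R + h) E) (cong (ℚ._* ι E) (ι-homo-+ R h))) ⟩
    (ι R ℚ.+ ι h) ℚ.* ι E ℚ.* 1/ι h           ≡⟨ solve 4 (λ r h e i → (r :+ h) :* e :* i := (h :* i :+ r :* i) :* e) refl (ι R) (ι h) (ι E) (1/ι h) ⟩
    (ι h ℚ.* 1/ι h ℚ.+ ι R ℚ.* 1/ι h) ℚ.* ι E ≡⟨ cong (λ x → (x ℚ.+ ι R ℚ.* 1/ι h) ℚ.* ι E) (ι*1/ι h) ⟩
    (1ℚ ℚ.+ ι R ℚ.* 1/ι h) ℚ.* ι E            ∎
    where
    open ℚₚ.≤-Reasoning
    open +-*-Solver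
    cancel : ∀ x → x ≡ x ℚ.* ι h ℚ.* 1/ι h
    cancel x = sym (trans (ℚₚ.*-assoc x (ι h) (1/ι h)) (trans (cong (x ℚ.*_) (ι*1/ι h)) (ℚₚ.*-identityʳ x)))

  sum-bound : ∀ {M} (c h : Vector ℕ M) (h≢0 : ∀ i → NonZero (h i)) →
              (∀ i → c i * h i ≤ (R + h i) * E) →
              ι (sum c) ℚ.≤ (ι M ℚ.+ ι R ℚ.* sumInverses h h≢0) ℚ.* ι E
  sum-bound {zero} c h h≢0 ch≤ rewrite ι≡fromℤ 0 = ℚₚ.≤-reflexive
    (solve 2 (λ r e → con 0ℚ := (con 0ℚ :+ r :* con 0ℚ) :* e) refl (ι R) (ι E))
    where open +-*-Solver
  sum-bound {suc M} c h h≢0 ch≤ = begin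
    ι (c zero + sum (tail c))          ≡⟨ ι-homo-+ (c zero) _ ⟩
    ι (c zero) ℚ.+ ι (sum (tail c))    ≤⟨ ℚₚ.+-mono-≤ (divide-bound (c zero) (h zero) {{h≢0 zero}} (ch≤ zero))
                                            (sum-bound (tail c) (tail h) (h≢0 ∘ suc) (ch≤ ∘ suc)) ⟩
    (1ℚ ℚ.+ ι R ℚ.* i) ℚ.* ι E ℚ.+ (ι M ℚ.+ ι R ℚ.* S) ℚ.* ι E
                                       ≡⟨ solve 5 (λ m r e i s → (con 1ℚ :+ r :* i) :* e :+ (m :+ r :* s) :* e
                                                       := ((con 1ℚ :+ m) :+ r :* (i :+ s)) :* e)
                                            refl (ι M) (ι R) (ι E) i S ⟩
    (1ℚ ℚ.+ ι M ℚ.+ ι R ℚ.* (i ℚ.+ S)) ℚ.* ι E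
                                       ≡⟨ cong (λ m → (m ℚ.+ ι R ℚ.* (i ℚ.+ S)) ℚ.* ι E) (ι-suc M) ⟨
    (ι (suc M) ℚ.+ ι R ℚ.* (i ℚ.+ S)) ℚ.* ι E ∎
    where
    open ℚₚ.≤-Reasoning
    open +-*-Solver
    i = 1/ι (h zero) {{h≢0 zero}}
    S = sumInverses (tail h) (h≢0 ∘ suc)

-- Choice of the radius.

module Radius (M : ℕ) (S : ℚ) where

  -- Multiplied by `(R + 1)ᴺ`, this compares the bound for all zeros with the number of points of
  -- the box in `N + 2` variables.
  Large : ℕ → Set
  Large R = ι M ℚ.+ ι R ℚ.* S ℚ.< ι (suc R * suc R)

  -- Provides the starting point for the downward search.
  large-M : S ℚ.≤ ι M → Large M
  large-M S≤M = begin-strict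
    ι M ℚ.+ ι M ℚ.* S    ≤⟨ ℚₚ.+-monoʳ-≤ (ι M) (ℚₚ.*-monoˡ-≤-nonNeg (ι M) {{ι-nonNeg M}} S≤M) ⟩
    ι M ℚ.+ ι M ℚ.* ι M  ≡⟨ cong (ι M ℚ.+_) (ι-homo-* M M) ⟨
    ι M ℚ.+ ι (M * M)    ≡⟨ ι-homo-+ M (M * M) ⟨
    ι (M + M * M)        <⟨ ι-mono-< (s≤s (+-monoʳ-≤ M (*-monoʳ-≤ M (n≤1+n M)))) ⟩
    ι (suc M * suc M)    ∎
    where open ℚₚ.≤-Reasoning

  -- Take `u > S` and `v > 0` with `v² > M`. If `u + v ≤ r` with `r = k + 1`, then `v ≤ r` because
  -- `u > 0`, and `M + k S < v² + r u ≤ r (u + v) ≤ r²` would make `k` large.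
  least-large≤ : ∀ R → (∀ k → R ≡ suc k → ¬ Large k) → 0ℚ ℚ.≤ S →
                 ⟦ ι R ⟧ ≤ᴿ ⟦ S ⟧ +ᴿ √ M
  least-large≤ zero least 0≤S (u , v , S<u , (0<v , M<v²) , refl) =
    subst (ℚ._< u ℚ.+ v) (sym (ι≡fromℤ 0)) (ℚₚ.+-mono-< (ℚₚ.≤-<-trans 0≤S S<u) 0<v)
  least-large≤ (suc k) least 0≤S (u , v , S<u , (0<v , M<v²) , refl) with ι (suc k) ℚₚ.<? u ℚ.+ v
  ... | yes r<u+v = r<u+v
  ... | no  r≮u+v = contradiction (begin-strict
    ι M ℚ.+ ι k ℚ.* S                   <⟨ ℚₚ.+-mono-<-≤ (subst (ℚ._< v ℚ.* v) (sym (ι-def M)) M<v²) (*-mono-≤-nonNeg 0≤r 0≤S (ι-mono-≤ (n≤1+n k)) (ℚₚ.<⇒≤ S<u)) ⟩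
    v ℚ.* v ℚ.+ r ℚ.* u                 ≤⟨ ℚₚ.+-monoˡ-≤ (r ℚ.* u) (ℚₚ.*-monoʳ-≤-nonNeg v {{ℚ.nonNegative (ℚₚ.<⇒≤ 0<v)}} v≤r) ⟩
    r ℚ.* v ℚ.+ r ℚ.* u                 ≡⟨ solve 3 (λ r u v → r :* v :+ r :* u := r :* (u :+ v)) refl r u v ⟩
    r ℚ.* (u ℚ.+ v)                     ≤⟨ ℚₚ.*-monoˡ-≤-nonNeg r {{ι-nonNeg (suc k)}} u+v≤r ⟩
    r ℚ.* r                             ≡⟨ ι-homo-* (suc k) (suc k) ⟨
    ι (suc k * suc k)                   ∎) (least k refl)
    where
    open ℚₚ.≤-Reasoning
    open +-*-Solver
    r = ι (suc k)
    0≤r = ℚₚ.nonNegative⁻¹ r {{ι-nonNeg (suc k)}}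
    u+v≤r = ℚₚ.≮⇒≥ r≮u+v
    v≤r : v ℚ.≤ r
    v≤r = ℚₚ.≤-trans (subst (ℚ._≤ u ℚ.+ v) (ℚₚ.+-identityˡ v) (ℚₚ.+-monoˡ-≤ v (ℚₚ.<⇒≤ (ℚₚ.≤-<-trans 0≤S S<u)))) u+v≤r

-- Existence of the point.

avoiding-point : ∀ {N M} (L : Vector (LinearForm (2 + N)) M) (h≢0 : ∀ i → NonZero (height (L i))) →
                 (∀ i → RelativelyPrime (L i)) →
                 Σ[ x ∈ Vector ℤ (2 + N) ] (∀ i → eval (L i) x ≢ 0ℤ) ×
                 (⟦ ι (height x) ⟧ ≤ᴿ ⟦ sumInverses (height ∘ L) h≢0 ⟧ +ᴿ √ M)
avoiding-point {N} {M} L h≢0 prime =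
  let R , large , minimal = least (λ R → _ ℚₚ.<? _) M (large-M (sumInverses≤M (height ∘ L) h≢0))
      x , hx≤R , avoids   = sum-zeros<⇒∃x R L (λ _ → 0ℤ) (few-zeros R large)
  in x , (λ i → avoids i ∘ trans (ℤₚ.+-identityˡ _)) ,
     λ s∈ → ℚₚ.≤-<-trans (ι-mono-≤ hx≤R)
              (least-large≤ R minimal (sumInverses-nonNeg (height ∘ L) h≢0) s∈)
  where
  open Box
  S = sumInverses (height ∘ L) h≢0
  open Radius M S

  few-zeros : ∀ R → Large R → sum (λ i → zeros R (L i) 0ℤ) < side R ^ (2 + N)
  few-zeros R large = ι-cancel-< (begin-strict
    ι (sum (λ i → zeros R (L i) 0ℤ)) ≤⟨ sum-bound R E (λ i → zeros R (L i) 0ℤ) (height ∘ L) h≢0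
                                          (λ i → zeros-bound R (L i) 0ℤ {{h≢0 i}} (prime i)) ⟩
    (ι M ℚ.+ ι R ℚ.* S) ℚ.* ι E      <⟨ ℚₚ.*-monoˡ-<-pos (ι E) {{ι-pos E {{m^n≢0 (side R) N}}}} large ⟩
    ι (side R * side R) ℚ.* ι E      ≡⟨ ι-homo-* (side R * side R) E ⟨
    ι (side R * side R * E)          ≡⟨ cong ι (*-assoc (side R) (side R) E) ⟩
    ι (side R ^ (2 + N))             ∎)
    where
    open ℚₚ.≤-Reasoning
    E = side R ^ N

corollary5p1 : (N M : ℕ) → 2 ≤ N → 1 ≤ M →
    (L : Vector (LinearForm N) M) →
    (L≢0 : ∀ i → NonZeroForm (L i)) →
    (∀ i → RelativelyPrime (L i)) →
    Σ[ x ∈ Vector ℤ N ] (∀ i → eval (L i) x ≢ 0ℤ) ×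
    (⟦ + height x / 1 ⟧ ≤ᴿ ⟦ sumInverseHeights L L≢0 ⟧ +ᴿ √ M)
corollary5p1 (suc (suc N)) M _ _ L L≢0 prime =
  let x , avoids , small = avoiding-point L (λ i → height-nonZero (L i) (L≢0 i)) prime
  -- The opaque rationals are exchanged for those of the statement.
  in x , avoids , subst₂ (λ r S → ⟦ r ⟧ ≤ᴿ ⟦ S ⟧ +ᴿ √ M) (ι-def (height x)) (sum-1/ι≡ L≢0) small
  where
  sum-1/ι≡ : ∀ {N M} {L : Vector (LinearForm N) M} (L≢0 : ∀ i → NonZeroForm (L i)) →
             sumInverses (height ∘ L) (λ i → height-nonZero (L i) (L≢0 i)) ≡ sumInverseHeights L L≢0
  sum-1/ι≡ {M = zero}          L≢0 = refl
  sum-1/ι≡ {M = suc _} {L = L} L≢0 = cong₂ ℚ._+_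
    (1/ι-def (height (L zero)) {{height-nonZero (L zero) (L≢0 zero)}}) (sum-1/ι≡ (L≢0 ∘ suc))
corollary5p1 1 M (s≤s ())
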